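{- If $L$ and $R$ are oriented graphs with $\operatorname{inv}(L)=\operatorname{inv}(R)=2$, then $\operatorname{inv}(L\rightarrow R)=4$.
   Context: All digraphs are oriented graphs: directed graphs without loops, digons or parallel edges. For a digraph $D$ and $X\subseteq V(D)$, inverting $X$ in $D$ means reversing the direction of every edge with both endpoints in $X$. A family $X_1,\dots,X_k\subseteq V(D)$ is a decycling family of $D$ if inverting $X_1,\dots,X_k$ in turn yields an acyclic digraph; $\operatorname{inv}(D)$ is the minimum size of a decycling family of $D$. For oriented graphs $L,R$, the dijoin $L\rightarrow R$ consists of vertex-disjoint copies of $L$ and $R$ together with an edge $\vec{uv}$ for every $u\in V(L)$, $v\in V(R)$. -}

module Defs where

open import Data.Nat using (ℕ; _<_; _+_)
open import Data.Bool using (Bool; true; false; _∧_; if_then_else_)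
open import Data.Fin using (Fin; splitAt)
open import Data.Fin.Subset using (Subset)
open import Data.Vec using (Vec; lookup; foldl)
open import Data.Sum using (inj₁; inj₂)
open import Data.Product using (Σ; _×_)
open import Relation.Binary.PropositionalEquality using (_≡_)
open import Relation.Binary.Construct.Closure.Transitive using (TransClosure)
open import Relation.Nullary using (¬_)

Digraph : ℕ → Set
Digraph n = Fin n → Fin n → Bool

Edge : ∀ {n} → Digraph n → Fin n → Fin n → Set
Edge D u v = D u v ≡ true

record IsOriented {n : ℕ} (D : Digraph n) : Set where
  field
    loopless : ∀ u → D u u ≡ false
    no-digon : ∀ u v → D u v ≡ true → D v u ≡ false

invert : ∀ {n} → Digraph n → Subset n → Digraph n
invert D X u v = if lookup X u ∧ lookup X v then D v u else D u v

invertAll : ∀ {n k} → Digraph n → Vec (Subset n) k → Digraph n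
invertAll D Xs = foldl (λ _ → Digraph _) invert D Xs

Acyclic : ∀ {n} → Digraph n → Set
Acyclic D = ∀ v → ¬ TransClosure (Edge D) v v

IsDecyclingFamily : ∀ {n k} → Digraph n → Vec (Subset n) k → Set
IsDecyclingFamily D Xs = Acyclic (invertAll D Xs)

HasDecyclingFamilyOfSize : ∀ {n} → Digraph n → ℕ → Set
HasDecyclingFamilyOfSize {n} D k = Σ (Vec (Subset n) k) (IsDecyclingFamily D)

InvIs : ∀ {n} → Digraph n → ℕ → Set
InvIs D k = HasDecyclingFamilyOfSize D k × (∀ m → m < k → ¬ HasDecyclingFamilyOfSize D m)

dijoin : ∀ {nL nR} → Digraph nL → Digraph nR → Digraph (nL + nR)
dijoin {nL} L R u v with splitAt nL u | splitAt nL v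
... | inj₁ a | inj₁ b = L a b
... | inj₂ a | inj₂ b = R a b
... | inj₁ _ | inj₂ _ = true
... | inj₂ _ | inj₁ _ = false

{-# OPTIONS --safe #-}
module Submission where

-- A decycling family of size k labels every vertex by a vector of 𝔽₂ᵏ, and an
-- edge is reversed exactly when the labels of its ends have inner product 1.
-- Suppose L → R is decycled with labels in 𝔽₂³, let A and B be the sets of
-- labels on L and on R, and order A by a ≤ c iff a ∙ b ≤ c ∙ b for all b ∈ B.
-- Short cycles through both sides show that any two labels in A are comparable
-- and that the decycled copy of L only has edges along this preorder; likewise
-- on R, with the order reversed.  A linear functional s is itself a single
-- inversion; it decycles L as soon as the preorder on A forces every cycle left
-- by it into a part of the decycled copy of L that it either keeps or reverses.
-- It is a finite fact about pairs of subsets of 𝔽₂³ that such an s exists for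
-- L or for R, so that one of the two has inversion number at most 1.

open import Defs
open import Data.Bool as Bool using (Bool; true; false; T; _∧_; _∨_; _xor_; not; if_then_else_)
open import Data.Bool.ListAction using (all; any)
open import Data.Bool.Properties using (∧-comm; T?; T-∧; T-∨; T-≡; T-not-≡; xor-identityʳ)
open import Data.Empty using (⊥)
open import Data.Fin using (Fin; splitAt; _↑ˡ_; _↑ʳ_)
import Data.Fin.Properties as Fin
open import Data.Fin.Subset using (Subset)
open import Data.List using (List; []; _∷_; map; _++_)
open import Data.List.Membership.Propositional using (_∈_; find)
open import Data.List.Membership.Propositional.Properties using (∈-map⁺; ∈-++⁺ˡ; ∈-++⁺ʳ)
open import Data.List.Relation.Unary.All as All using (All; []; _∷_)
open import Data.List.Relation.Unary.All.Properties using (all⁺; all⁻; ¬All⇒Any¬)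
open import Data.List.Relation.Unary.Any using (here; there; satisfied)
open import Data.List.Relation.Unary.Any.Properties using (any⁻)
open import Data.Nat using (ℕ; zero; suc; _+_; _≤′_; ≤′-refl; ≤′-step; s≤s; z≤n)
open import Data.Nat.Properties using (≤⇒≤′; ≤-pred)
open import Data.Product using (_×_; _,_; ∃; proj₁; proj₂)
open import Data.Sum using (_⊎_; inj₁; inj₂; [_,_]′)
open import Data.Sum.Relation.Binary.LeftOrder using (_⊎-<_; ₁∼₂; ₁∼₁; ₂∼₂; ⊎-<-transitive)
open import Data.Unit using (⊤; tt)
open import Data.Vec as Vec using (Vec; []; _∷_; lookup; replicate)
import Data.Vec.Properties as Vec
open import Function using (_∘_; id)
open import Function.Bundles using (Equivalence)
open import Relation.Binary using (Rel; _=[_]⇒_; Transitive)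
open import Relation.Binary.Construct.Closure.Transitive
  using (TransClosure; [_]; _∷_; transitive; transitive⁻)
open import Relation.Binary.PropositionalEquality
open import Relation.Nullary using (yes; no; ¬_; contradiction)
open import Relation.Nullary.Decidable using (decidable-stable)
open import Relation.Unary using (Pred; Decidable)
open import Level using (0ℓ)

private variable
  n k m : ℕ
  V W X : Set

-- Cycles in ordered sums and under reversal of edges

gmap⁺ : {R : Rel V 0ℓ} {S : Rel W 0ℓ} (f : V → W) → R =[ f ]⇒ S →
        TransClosure R =[ f ]⇒ TransClosure S
gmap⁺ f g [ r ]    = [ g r ]
gmap⁺ f g (r ∷ rs) = g r ∷ gmap⁺ f g rs

NoCycle : Rel V 0ℓ → Set
NoCycle R = ∀ v → ¬ TransClosure R v v

-- Closing both sides transitively makes the ordered sum transitive, so a cycle collapses to one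
-- step from `v` to itself, which lies on one side.
⊎-<-noCycle : {R : Rel V 0ℓ} {S : Rel W 0ℓ} → NoCycle R → NoCycle S → NoCycle (R ⊎-< S)
⊎-<-noCycle {R = R} {S} noR noS v cycle
  with transitive⁻ _ (⊎-<-transitive (transitive R) (transitive S)) (gmap⁺ id step cycle)
  where
  step : (R ⊎-< S) =[ id ]⇒ (TransClosure R ⊎-< TransClosure S)
  step ₁∼₂     = ₁∼₂
  step (₁∼₁ r) = ₁∼₁ [ r ]
  step (₂∼₂ s) = ₂∼₂ [ s ]
... | ₁∼₁ rs = noR _ rs
... | ₂∼₂ ss = noS _ ss

-- A cycle of E′ stays within one class of the preorder ≲, and on such a class
-- flip is constant; so the cycle is a cycle of E or of the converse of E.
module _ {E E′ : Rel V 0ℓ} {_≲_ : Rel V 0ℓ} (flip : V → V → Bool)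
  (flip-comm : ∀ u v → flip u v ≡ flip v u)
  (≲-trans : Transitive _≲_)
  (flip-const : ∀ {u v} → u ≲ v → v ≲ u → flip u v ≡ flip u u)
  (E′⇒≲ : ∀ {u v} → E′ u v → u ≲ v)
  (E′⇒E : ∀ {u v} → E′ u v → if flip u v then E v u else E u v)
  where

  private
    flip-class : ∀ {u v} → u ≲ v → v ≲ u → flip u u ≡ flip v v
    flip-class {u} {v} p q = begin
      flip u u ≡⟨ flip-const p q ⟨
      flip u v ≡⟨ flip-comm u v ⟩
      flip v u ≡⟨ flip-const q p ⟩
      flip v v ∎
      where open ≡-Reasoning

    walk⇒≲ : ∀ {u v} → TransClosure E′ u v → u ≲ v
    walk⇒≲ = transitive⁻ _ ≲-trans ∘ gmap⁺ id E′⇒≲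

    Oriented : Bool → Rel V 0ℓ
    Oriented true  u v = TransClosure E v u
    Oriented false u v = TransClosure E u v

    orient : ∀ b {u v} → (if b then E v u else E u v) → Oriented b u v
    orient true  e = [ e ]
    orient false e = [ e ]

    join : ∀ b {u v w} → Oriented b u v → Oriented b v w → Oriented b u w
    join true  p q = transitive E q p
    join false p q = transitive E p q

    edge : ∀ {u v} → E′ u v → v ≲ u → Oriented (flip u u) u v
    edge {u} {v} e v≲u =
      subst (λ b → Oriented b u v) (flip-const (E′⇒≲ e) v≲u) (orient (flip u v) (E′⇒E e))

    walk : ∀ {u v} → TransClosure E′ u v → v ≲ u → Oriented (flip u u) u v
    walk [ e ] v≲u = edge e v≲u
    walk {u} {v} (_∷_ {y = w} e es) v≲u =
      -- The rest of the walk is oriented by `flip w w`, which agrees with `flip u u` because `u`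
      -- and `w` lie in one class.
      join (flip u u) (edge e w≲u)
        (subst (λ b → Oriented b w v) (flip-class w≲u (E′⇒≲ e))
          (walk es (≲-trans v≲u (E′⇒≲ e))))
      where w≲u = ≲-trans (walk⇒≲ es) v≲u

  noCycle-flip : NoCycle E → NoCycle E′
  noCycle-flip noE v cycle = closed (flip v v) (walk cycle (walk⇒≲ cycle))
    where
    closed : ∀ b → ¬ Oriented b v v
    closed true  = noE v
    closed false = noE v

-- Labellings by vectors over 𝔽₂

infix 8 _∙_

_∙_ : Vec Bool k → Vec Bool k → Bool
[]       ∙ []       = false
(a ∷ as) ∙ (b ∷ bs) = (a ∧ b) xor (as ∙ bs)

∙-comm : (a b : Vec Bool k) → a ∙ b ≡ b ∙ a
∙-comm []       []       = refl
∙-comm (a ∷ as) (b ∷ bs) = cong₂ _xor_ (∧-comm a b) (∙-comm as bs)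

twist : Digraph n → (Fin n → Vec Bool k) → Digraph n
twist D x u v = if x u ∙ x v then D v u else D u v

column : Vec (Subset n) k → Fin n → Vec Bool k
column Xs u = Vec.map (λ X → lookup X u) Xs

-- Each set containing both ends reverses the edge once; the inner product of the columns is the
-- parity of the number of such sets.
invertAll-twist : (D : Digraph n) (Xs : Vec (Subset n) k) →
                  ∀ u v → invertAll D Xs u v ≡ twist D (column Xs) u v
invertAll-twist D []       u v = refl
invertAll-twist D (X ∷ Xs) u v
  rewrite invertAll-twist (invert D X) Xs u v
  with lookup X u | lookup X v | column Xs u ∙ column Xs v
... | false | false | _     = refl
... | false | true  | _     = refl
... | true  | false | _     = refl
... | true  | true  | false = refl
... | true  | true  | true  = refl

family : (Fin n → Vec Bool k) → Vec (Subset n) k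
family x = Vec.tabulate λ i → Vec.tabulate λ u → lookup (x u) i

column-family : (x : Fin n → Vec Bool k) → ∀ u → column (family x) u ≡ x u
column-family x u = begin
  column (family x) u
    ≡⟨ Vec.tabulate-∘ (λ X → lookup X u) _ ⟨
  Vec.tabulate (λ i → lookup (Vec.tabulate λ v → lookup (x v) i) u)
    ≡⟨ Vec.tabulate-cong (λ i → Vec.lookup∘tabulate (λ v → lookup (x v) i) u) ⟩
  Vec.tabulate (lookup (x u))
    ≡⟨ Vec.tabulate∘lookup (x u) ⟩
  x u ∎
  where open ≡-Reasoning

Acyclic-resp : {D D′ : Digraph n} → (∀ u v → D u v ≡ D′ u v) → Acyclic D → Acyclic D′
Acyclic-resp eq acyclic v = acyclic v ∘ gmap⁺ id (trans (eq _ _))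

Labelled : Digraph n → ℕ → Set
Labelled {n} D k = ∃ λ (x : Fin n → Vec Bool k) → Acyclic (twist D x)

toLabelled : {D : Digraph n} → HasDecyclingFamilyOfSize D k → Labelled D k
toLabelled {D = D} (Xs , acyclic) = column Xs , Acyclic-resp (invertAll-twist D Xs) acyclic

fromLabelled : {D : Digraph n} → Labelled D k → HasDecyclingFamilyOfSize D k
fromLabelled {D = D} (x , acyclic) = family x , Acyclic-resp eq acyclic
  where
  eq : ∀ u v → twist D x u v ≡ invertAll D (family x) u v
  eq u v rewrite invertAll-twist D (family x) u v
               | column-family x u | column-family x v = refl

-- A zero coordinate stands for the empty set, whose inversion changes nothing.
pad : {D : Digraph n} → m ≤′ k → Labelled D m → Labelled D k
pad ≤′-refl     l = l
pad (≤′-step p) l with x , acyclic ← pad p l = (λ u → false ∷ x u) , acyclic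

-- Dijoins

dijoin-LL : (L : Digraph n) (R : Digraph m) → ∀ a c → dijoin L R (a ↑ˡ m) (c ↑ˡ m) ≡ L a c
dijoin-LL {n} {m} L R a c rewrite Fin.splitAt-↑ˡ n a m | Fin.splitAt-↑ˡ n c m = refl

dijoin-LR : (L : Digraph n) (R : Digraph m) → ∀ a b → dijoin L R (a ↑ˡ m) (n ↑ʳ b) ≡ true
dijoin-LR {n} {m} L R a b rewrite Fin.splitAt-↑ˡ n a m | Fin.splitAt-↑ʳ n m b = refl

dijoin-RR : (L : Digraph n) (R : Digraph m) → ∀ b d → dijoin L R (n ↑ʳ b) (n ↑ʳ d) ≡ R b d
dijoin-RR {n} {m} L R b d rewrite Fin.splitAt-↑ʳ n m b | Fin.splitAt-↑ʳ n m d = refl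

++0∙++0 : (a c : Vec Bool k) → (a Vec.++ replicate m false) ∙ (c Vec.++ replicate m false) ≡ a ∙ c
++0∙++0 {m = zero}  []       []       = refl
++0∙++0 {m = suc m} []       []       = ++0∙++0 {m = m} [] []
++0∙++0             (a ∷ as) (c ∷ cs) = cong ((a ∧ c) xor_) (++0∙++0 as cs)

0++∙0++ : ∀ k (b d : Vec Bool m) → (replicate k false Vec.++ b) ∙ (replicate k false Vec.++ d) ≡ b ∙ d
0++∙0++ zero    b d = refl
0++∙0++ (suc k) b d = 0++∙0++ k b d

++0∙0++ : (a : Vec Bool k) (b : Vec Bool m) →
          (a Vec.++ replicate m false) ∙ (replicate k false Vec.++ b) ≡ false
++0∙0++ []           []      = refl
++0∙0++ []           (_ ∷ b) = ++0∙0++ [] b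
++0∙0++ (false ∷ as) b       = ++0∙0++ as b
++0∙0++ (true  ∷ as) b       = ++0∙0++ as b

-- The two sides use disjoint blocks of coordinates, so edges across keep their direction and the
-- result is an ordered sum of acyclic digraphs.
dijoin-labelled : (L : Digraph n) (R : Digraph m) {j k : ℕ} →
                  Labelled L j → Labelled R k → Labelled (dijoin L R) (j + k)
dijoin-labelled {n} {m} L R {j} {k} (x , acyclicL) (y , acyclicR) = z , acyclic
  where
  z : Fin (n + m) → Vec Bool (j + k)
  z u = [ (λ a → x a Vec.++ replicate k false) , (λ b → replicate j false Vec.++ y b) ]′ (splitAt n u)

  E : Rel (Fin n ⊎ Fin m) 0ℓ
  E = Edge (twist L x) ⊎-< Edge (twist R y)

  edge : Edge (twist (dijoin L R) z) =[ splitAt n ]⇒ E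
  edge {u} {v} e with splitAt n u | splitAt n v
  ... | inj₁ a | inj₁ c rewrite ++0∙++0 {m = k} (x a) (x c) = ₁∼₁ e
  ... | inj₁ a | inj₂ b = ₁∼₂
  ... | inj₂ b | inj₁ a
    rewrite ∙-comm (replicate j false Vec.++ y b) (x a Vec.++ replicate k false)
          | ++0∙0++ (x a) (y b)
    with () ← e
  ... | inj₂ b | inj₂ d rewrite 0++∙0++ j (y b) (y d) = ₂∼₂ e

  acyclic : Acyclic (twist (dijoin L R) z)
  acyclic u cycle = ⊎-<-noCycle acyclicL acyclicR (splitAt n u) (gmap⁺ (splitAt n) edge cycle)

-- The finite problem

infixr 4 _⇒ᵇ_
infix 5 _==_

_⇒ᵇ_ _==_ : Bool → Bool → Bool
a ⇒ᵇ b = not a ∨ b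
a == b = not (a xor b)

⇒ᵇ-elim : ∀ a {b} → T (a ⇒ᵇ b) → T a → T b
⇒ᵇ-elim true t _ = t

⇒ᵇ-intro : ∀ a {b} → (T a → T b) → T (a ⇒ᵇ b)
⇒ᵇ-intro true  f = f tt
⇒ᵇ-intro false f = tt

==⇒≡ : ∀ a b → T (a == b) → a ≡ b
==⇒≡ false false _ = refl
==⇒≡ true  true  _ = refl

below : List (Vec Bool k) → Vec Bool k → Vec Bool k → Bool
below B a c = all (λ b → a ∙ b ⇒ᵇ c ∙ b) B

-- Fails exactly when some `a`, `c` in `A` and `b`, `d` in `B` make `a ∙ b` and `c ∙ d` true but
-- `c ∙ b` and `a ∙ d` false. Hence it passes to sublists of `B` and can prune the search.
comparable : List (Vec Bool k) → List (Vec Bool k) → Bool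
comparable A B = all (λ a → all (λ c → below B a c ∨ below B c a) A) A

-- Whether inverting by the functional s instead of by the labels themselves
-- changes the direction of an edge between vertices labelled a and c.
flips : Vec Bool k → Vec Bool k → Vec Bool k → Bool
flips s a c = a ∙ c xor ((s ∙ a) ∧ (s ∙ c))

-- Whether an edge from label a to label c is possible after inverting by s.
reach : List (Vec Bool k) → Vec Bool k → Vec Bool k → Vec Bool k → Bool
reach B s a c = if flips s a c then below B c a else below B a c

-- On `A` the inner product equals the rank-one form `(s ∙ a) ∧ (s ∙ c)`, so inverting by `s` alone
-- has the same effect as the labels.
fixing : List (Vec Bool k) → Vec Bool k → Bool
fixing A s = all (λ a → all (λ c → not (flips s a c)) A) A

-- These are the conditions of `noCycle-flip`: on `A`, `reach B s` is transitive and `flips s` is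
-- constant on its classes.
certifies : List (Vec Bool k) → List (Vec Bool k) → Vec Bool k → Bool
certifies A B s =
  all (λ a → all (λ c → reach B s a c ⇒ᵇ
    (reach B s c a ⇒ᵇ flips s a c == flips s a a) ∧
    all (λ d → reach B s c d ⇒ᵇ reach B s a d) A) A) A

vectors : ∀ k → List (Vec Bool k)
vectors zero    = [] ∷ []
vectors (suc k) = map (false ∷_) (vectors k) ++ map (true ∷_) (vectors k)

∈-vectors : (a : Vec Bool k) → a ∈ vectors k
∈-vectors []          = here refl
∈-vectors (false ∷ a) = ∈-++⁺ˡ (∈-map⁺ (false ∷_) (∈-vectors a))
∈-vectors (true ∷ a)  = ∈-++⁺ʳ _ (∈-map⁺ (true ∷_) (∈-vectors a))

-- Tests f on all extensions of c by sublists of the second list, pruning as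
-- soon as the list built so far violates the hereditary property ok.
search : (ok f : List X → Bool) → List X → List X → Bool
search ok f c []       = f c
search ok f c (a ∷ as) = search ok f c as ∧ (ok (a ∷ c) ⇒ᵇ search ok f (a ∷ c) as)

-- Follow the branch that takes exactly the entries satisfying `P`; by `okP` it is never pruned.
search-sound : {P : Pred X 0ℓ} → Decidable P → {ok f : List X → Bool} →
               (∀ {l} → All P l → T (ok l)) →
               ∀ {c} → All P c → ∀ as → T (search ok f c as) →
               ∃ λ l → All P l × (∀ {a} → a ∈ c → a ∈ l) ×
                       (∀ {a} → a ∈ as → P a → a ∈ l) × T (f l)
search-sound P? okP {c} Pc [] t = c , Pc , id , (λ ()) , t
search-sound {P = P} P? {ok} okP {c} Pc (a ∷ as) t
  with t₁ , t₂ ← Equivalence.to T-∧ t | P? a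
... | no ¬Pa with l , Pl , c⊆l , as⊆l , fl ← search-sound P? okP Pc as t₁ =
  l , Pl , c⊆l , (λ { (here refl) Pa → contradiction Pa ¬Pa ; (there i) → as⊆l i }) , fl
... | yes Pa with l , Pl , c⊆l , as⊆l , fl ←
    search-sound P? okP (Pa ∷ Pc) as (⇒ᵇ-elim (ok (a ∷ c)) t₂ (okP (Pa ∷ Pc))) =
  l , Pl , c⊆l ∘ there , (λ { (here refl) _ → c⊆l (here refl) ; (there i) → as⊆l i }) , fl

-- A functional fixing A also certifies A against every B for which A is a
-- chain; testing for it first only keeps the search small.
solvable : List (Vec Bool k) → List (Vec Bool k) → Bool
solvable {k} A B =
  any (fixing B) (vectors k) ∨ any (λ s → certifies A B s ∨ certifies B A s) (vectors k)

solvable-all : ℕ → Bool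
solvable-all k = search (λ _ → true)
  (λ A → any (fixing A) (vectors k) ∨ search (comparable A) (solvable A) [] (vectors k))
  [] (vectors k)

-- From a functional to a single inversion

if-map : ∀ b {P Q : Set} {p q : Bool} → (P → T p) → (Q → T q) →
         (if b then P else Q) → T (if b then p else q)
if-map true  f g = f
if-map false f g = g

flips-comm : (s a c : Vec Bool k) → flips s a c ≡ flips s c a
flips-comm s a c = cong₂ _xor_ (∙-comm a c) (∧-comm (s ∙ a) (s ∙ c))

module _ {D : Digraph n} {x : Fin n → Vec Bool k} (acyclic : Acyclic (twist D x))
  {A : List (Vec Bool k)} (x∈A : ∀ u → x u ∈ A) (s : Vec Bool k) where

  private
    single : Fin n → Vec Bool 1
    single u = s ∙ x u ∷ []

    E E′ : Rel (Fin n) 0ℓ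
    E  = Edge (twist D x)
    E′ = Edge (twist D single)

    flip : Fin n → Fin n → Bool
    flip u v = flips s (x u) (x v)

    E′⇒E : ∀ {u v} → E′ u v → if flip u v then E v u else E u v
    E′⇒E {u} {v} e
      rewrite xor-identityʳ ((s ∙ x u) ∧ (s ∙ x v)) | ∙-comm (x v) (x u)
      with x u ∙ x v | (s ∙ x u) ∧ (s ∙ x v)
    ... | false | false = e
    ... | false | true  = e
    ... | true  | false = e
    ... | true  | true  = e

  fixing-labelled : T (fixing A s) → Labelled D 1
  fixing-labelled t = single ,
    -- No edge is flipped, so the trivial preorder with a single class suffices.
    noCycle-flip {E = E} {E′} {λ _ _ → ⊤} flip (λ u v → flips-comm s (x u) (x v)) (λ _ _ → tt)
      (λ {u} {v} _ _ → trans (unflipped u v) (sym (unflipped u u))) (λ _ → tt) E′⇒E acyclic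
    where
    unflipped : ∀ u v → flip u v ≡ false
    unflipped u v = Equivalence.to T-not-≡
      (All.lookup (all⁺ _ A (All.lookup (all⁺ _ A t) (x∈A u))) (x∈A v))

  module _ {B : List (Vec Bool k)} (t : T (certifies A B s)) where

    private
      Reach : Rel (Fin n) 0ℓ
      Reach u v = T (reach B s (x u) (x v))

      certificate : ∀ {u v} → Reach u v → (Reach v u → flip u v ≡ flip u u) ×
                                          (∀ {w} → Reach v w → Reach u w)
      certificate {u} {v} r
        with t₁ , t₂ ← Equivalence.to T-∧
               (⇒ᵇ-elim (reach B s (x u) (x v))
                 (All.lookup (all⁺ _ A (All.lookup (all⁺ _ A t) (x∈A u))) (x∈A v)) r) =
        (λ r′ → ==⇒≡ _ _ (⇒ᵇ-elim (reach B s (x v) (x u)) t₁ r′)) ,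
        (λ {w} → ⇒ᵇ-elim (reach B s (x v) (x w)) (All.lookup (all⁺ _ A t₂) (x∈A w)))

    certifies-labelled : (∀ {u v} → E u v → T (below B (x u) (x v))) → Labelled D 1
    certifies-labelled mono = single ,
      noCycle-flip {E = E} {E′} {Reach} flip (λ u v → flips-comm s (x u) (x v))
        (λ p q → proj₂ (certificate p) q) (λ p q → proj₁ (certificate p) q)
        (λ {u} {v} e → if-map (flip u v) mono mono (E′⇒E e)) E′⇒E acyclic

    certifies-labelledᵒᵖ : (∀ {u v} → E u v → T (below B (x v) (x u))) → Labelled D 1
    certifies-labelledᵒᵖ anti = single ,
      -- Edges now go down the preorder, hence the transpose of `Reach`.
      noCycle-flip {E = E} {E′} {λ u v → Reach v u} flip (λ u v → flips-comm s (x u) (x v))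
        (λ p q → proj₂ (certificate q) p) (λ p q → proj₁ (certificate q) p)
        (λ {u} {v} e → subst (λ b → T (if b then _ else _)) (flips-comm s (x u) (x v))
          (if-map (flip u v) anti anti (E′⇒E e)))
        E′⇒E acyclic

-- Short cycles through both sides of a dijoin

¬⇒ᵇ : ∀ a b → ¬ T (a ⇒ᵇ b) → a ≡ true × b ≡ false
¬⇒ᵇ false b     ¬t = contradiction tt ¬t
¬⇒ᵇ true  false ¬t = refl , refl
¬⇒ᵇ true  true  ¬t = contradiction tt ¬t

-- If `all p xs` fails, it fails at some `a`, and `clash` against this `a` rules out every failure
-- of `q`.
all-∨-all : {P : Pred X 0ℓ} (p q : X → Bool) {xs : List X} → All P xs →
            (∀ {a b} → P a → P b → ¬ T (p a) → ¬ T (q b) → ⊥) →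
            T (all p xs ∨ all q xs)
all-∨-all p q {xs} Pxs clash with all p xs in eq
... | true  = tt
... | false with a , a∈xs , ¬pa ← find (¬All⇒Any¬ (T? ∘ p) xs λ ps → subst T eq (all⁻ p ps)) =
  all⁻ q (All.map (λ {b} Pb → decidable-stable (T? (q b)) (clash (All.lookup Pxs a∈xs) Pb ¬pa)) Pxs)

Image : {V W : Set} → (V → W) → Pred W 0ℓ
Image f b = ∃ λ u → f u ≡ b

image? : (x : Fin n → Vec Bool k) → Decidable (Image x)
image? x a = Fin.any? λ u → Vec.≡-dec Bool._≟_ (x u) a

module _ {k : ℕ} (L : Digraph n) (R : Digraph m) (z : Fin (n + m) → Vec Bool k)
  (acyclic : Acyclic (twist (dijoin L R) z)) where

  private
    x : Fin n → Vec Bool k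
    x a = z (a ↑ˡ m)

    y : Fin m → Vec Bool k
    y b = z (n ↑ʳ b)

    E : Rel (Fin (n + m)) 0ℓ
    E = Edge (twist (dijoin L R) z)

    L→L : ∀ {a c} → Edge (twist L x) a c → E (a ↑ˡ m) (c ↑ˡ m)
    L→L {a} {c} e rewrite dijoin-LL L R a c | dijoin-LL L R c a = e

    R→R : ∀ {b d} → Edge (twist R y) b d → E (n ↑ʳ b) (n ↑ʳ d)
    R→R {b} {d} e rewrite dijoin-RR L R b d | dijoin-RR L R d b = e

    L→R : ∀ {a b} → x a ∙ y b ≡ false → E (a ↑ˡ m) (n ↑ʳ b)
    L→R {a} {b} eq rewrite eq = dijoin-LR L R a b

    R→L : ∀ {a b} → x a ∙ y b ≡ true → E (n ↑ʳ b) (a ↑ˡ m)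
    R→L {a} {b} eq rewrite trans (∙-comm (y b) (x a)) eq = dijoin-LR L R a b

    acyclicL : Acyclic (twist L x)
    acyclicL a = acyclic (a ↑ˡ m) ∘ gmap⁺ (_↑ˡ m) L→L

    acyclicR : Acyclic (twist R y)
    acyclicR b = acyclic (n ↑ʳ b) ∘ gmap⁺ (n ↑ʳ_) R→R

    mono : ∀ {B} → All (Image y) B → ∀ {a c} → Edge (twist L x) a c → T (below B (x a) (x c))
    mono PB {a} {c} e = all⁻ _ (All.map step PB)
      where
      step : ∀ {b} → Image y b → T (x a ∙ b ⇒ᵇ x c ∙ b)
      step (v , refl) = decidable-stable (T? _) λ ¬t →
        let ab , cb = ¬⇒ᵇ _ _ ¬t in
        -- The triangle `v`, `a`, `c`.
        acyclic _ (R→L ab ∷ L→L e ∷ [ L→R cb ])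

    anti : ∀ {A} → All (Image x) A → ∀ {b d} → Edge (twist R y) b d → T (below A (y d) (y b))
    anti PA {b} {d} e = all⁻ _ (All.map step PA)
      where
      step : ∀ {a} → Image x a → T (y d ∙ a ⇒ᵇ y b ∙ a)
      step (u , refl) = decidable-stable (T? _) λ ¬t →
        let da , ba = ¬⇒ᵇ _ _ ¬t in
        acyclic _ (L→R (trans (∙-comm (x u) (y b)) ba) ∷ R→R e ∷
                   [ R→L (trans (∙-comm (x u) (y d)) da) ])

    comparable-images : ∀ {A B} → All (Image x) A → All (Image y) B → T (comparable A B)
    comparable-images {B = B} PA PB =
      all⁻ _ (All.map (λ a → all⁻ _ (All.map (λ c → chain a c) PA)) PA)
      where
      chain : ∀ {a c} → Image x a → Image x c → T (below B a c ∨ below B c a)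
      chain {a} {c} (u , refl) (w , refl) =
        all-∨-all (λ b → a ∙ b ⇒ᵇ c ∙ b) (λ b → c ∙ b ⇒ᵇ a ∙ b) PB λ where
          (b , refl) (d , refl) ¬p ¬q →
            let ub , wb = ¬⇒ᵇ _ _ ¬p
                wd , ud = ¬⇒ᵇ _ _ ¬q
            -- Two incomparable labels give the 4-cycle `b`, `u`, `d`, `w`.
            in acyclic _ (R→L {u} {b} ub ∷ L→R {u} {d} ud ∷ R→L {w} {d} wd ∷ [ L→R {w} {b} wb ])

    x∈ : ∀ {A} → (∀ {a} → a ∈ vectors k → Image x a → a ∈ A) → ∀ u → x u ∈ A
    x∈ A⊇ u = A⊇ (∈-vectors (x u)) (u , refl)

    y∈ : ∀ {B} → (∀ {b} → b ∈ vectors k → Image y b → b ∈ B) → ∀ v → y v ∈ B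
    y∈ B⊇ v = B⊇ (∈-vectors (y v)) (v , refl)

  dijoin-labelled⇒ : solvable-all k ≡ true → Labelled L 1 ⊎ Labelled R 1
  dijoin-labelled⇒ solved
    -- By `PA` and `A⊇`, `A` lists exactly the labels on `L`.
    with A , PA , _ , A⊇ , t ← search-sound (image? x) (λ _ → tt) [] (vectors k)
                                 (Equivalence.from T-≡ solved)
    with Equivalence.to T-∨ t
  ... | inj₁ t₁ = let s , fix = satisfied (any⁻ _ (vectors k) t₁) in
                  inj₁ (fixing-labelled acyclicL (x∈ A⊇) s fix)
  ... | inj₂ t₁
    with B , PB , _ , B⊇ , t₂ ← search-sound (image? y) (comparable-images PA) [] (vectors k) t₁
    with Equivalence.to T-∨ t₂
  ...   | inj₁ t₃ = let s , fix = satisfied (any⁻ _ (vectors k) t₃) in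
                    inj₂ (fixing-labelled acyclicR (y∈ B⊇) s fix)
  ...   | inj₂ t₃ with s , t₄ ← satisfied (any⁻ _ (vectors k) t₃) 
      with Equivalence.to (T-∨ {certifies A B s}) t₄
  ...     | inj₁ cert = inj₁ (certifies-labelled acyclicL (x∈ A⊇) s {B} cert (mono PB))
  ...     | inj₂ cert = inj₂ (certifies-labelledᵒᵖ acyclicR (y∈ B⊇) s {A} cert (anti PA))

theorem1p3 : ∀ {nL nR : ℕ} (L : Digraph nL) (R : Digraph nR) →
    IsOriented L → IsOriented R → InvIs L 2 → InvIs R 2 →
    InvIs (dijoin L R) 4
theorem1p3 L R _ _ (familyL , minL) (familyR , minR) =
  fromLabelled (dijoin-labelled L R (toLabelled familyL) (toLabelled familyR)) ,
  -- Any family of fewer than four sets is padded to exactly three; the final `refl` proves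
  -- `solvable-all 3 ≡ true` by evaluating the search.
  λ m m<4 fam → let z , acyclic = pad (≤⇒≤′ (≤-pred m<4)) (toLabelled fam) in
    [ minL 1 1<2 ∘ fromLabelled , minR 1 1<2 ∘ fromLabelled ]′ (dijoin-labelled⇒ L R z acyclic refl)
  where
  1<2 = s≤s (s≤s z≤n)
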